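{- For all positive integers $n\geq 2$ and $t$, the set $D_{n,t}$ is a dominating set of $S(K_n,t)$.
   Context: For a positive integer $n$ let $[n]=\{1,\dots,n\}$. For positive integers $n,t$, the Sierpiński graph $S(K_n,t)$ is the simple graph with vertex set $[n]^t$ (words $v_1v_2\cdots v_t$ with $v_i\in[n]$), in which $u_1\cdots u_t$ and $v_1\cdots v_t$ are adjacent if and only if there is $s\in[t]$ with $u_j=v_j$ for all $j<s$, $u_s\neq v_s$, and $u_j=v_s$ and $v_j=u_s$ for all $j>s$. A set of vertices is dominating if every vertex lies in it or is adjacent to one of its elements. Write $a^k$ for the word consisting of $k$ copies of the letter $a$. The sets $D_{n,t}\subseteq[n]^t$ are defined recursively: $D_{n,1}=\{1\}$, $D_{n,2}=\{11,21,\dots,n1\}$. For $t\geq 3$ and $\mathbf v=v_1\cdots v_{t-2}\in D_{n,t-2}$ put $E_1(\mathbf v)=\{v_1\cdots v_{t-2}\alpha\alpha:\alpha\in[n]\}$, $E_2(\mathbf v)=\{v_1\cdots v_{t-3}\alpha\beta v_{t-2}:\alpha,\beta\in[n]\setminus\{v_{t-2}\}\}$, and, if $\mathbf v$ is not a constant word, let $\ell$ be the largest index in $[t-3]$ with $v_\ell\neq v_{\ell+1}$ and put $E_3(\mathbf v)=\{v_1\cdots v_{\ell-1}v_{\ell+1}v_\ell^{\,t-\ell-2}\alpha v_\ell:\alpha\in[n]\setminus\{v_\ell\}\}$. If $t\geq 3$ is odd, $D_{n,t}=E_1(1^{t-2})\cup E_2(1^{t-2})\cup\bigcup_{\mathbf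 v\in D_{n,t-2}\setminus\{1^{t-2}\}}\big(E_1(\mathbf v)\cup E_2(\mathbf v)\cup E_3(\mathbf v)\big)$. If $t\geq 4$ is even, $D_{n,t}=\{1^{t-2}\alpha1:\alpha\in[n]\}\cup\bigcup_{\mathbf v\in D_{n,t-2}\setminus\{1^{t-2}\}}\big(E_1(\mathbf v)\cup E_2(\mathbf v)\cup E_3(\mathbf v)\big)$. (In this recursion $1^{t-2}\in D_{n,t-2}$ is the only constant word in $D_{n,t-2}$, so $E_3$ is applied only to non-constant words.) -}

module Defs where

open import Data.Fin.Base using (Fin; zero; suc; inject₁; _<_; _≤_)
open import Data.Nat.Base using (ℕ; zero; suc; NonZero; parity)
open import Data.Parity.Base using (Parity; 0ℙ; 1ℙ)
open import Data.Product.Base using (∃-syntax; _×_; _,_)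
open import Data.Sum.Base using (_⊎_)
open import Data.Vec.Base using (Vec; []; _∷_; _∷ʳ_; init; last; lookup; replicate)
open import Level using (0ℓ)
open import Relation.Binary.Core using (Rel)
open import Relation.Binary.Definitions using (Symmetric; Irreflexive)
open import Relation.Binary.PropositionalEquality using (_≡_; _≢_; refl; sym)
open import Relation.Unary using (Pred; _∈_; ∅; ｛_｝; _∪_; _∖_)

record SimpleGraph : Set₁ where
  field
    Vertex : Set
    Adj    : Rel Vertex 0ℓ
    symm   : Symmetric Adj
    irrefl : Irreflexive _≡_ Adj

open SimpleGraph public using (Vertex; Adj)

Dominating : (G : SimpleGraph) → Pred (Vertex G) 0ℓ → Set
Dominating G D = ∀ v → v ∈ D ⊎ (∃[ u ] u ∈ D × Adj G v u)

-- The letters 1, …, n are the elements of Fin n, and words are read from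
-- left to right, so v₁ is the head of the vector.

Word : ℕ → ℕ → Set
Word n t = Vec (Fin n) t

SierpińskiAdj : ∀ n t → Rel (Word n t) 0ℓ
SierpińskiAdj n t u v = ∃[ s ]
    (∀ j → j < s → lookup u j ≡ lookup v j)
  × lookup u s ≢ lookup v s
  × (∀ j → s < j → lookup u j ≡ lookup v s × lookup v j ≡ lookup u s)

S : ℕ → ℕ → SimpleGraph
S n t = record
  { Vertex = Word n t
  ; Adj    = SierpińskiAdj n t
  ; symm   = λ { (s , before , at , after) →
                 s , (λ j j<s → sym (before j j<s))
                   , (λ eq → at (sym eq))
                   , (λ j s<j → let p , q = after j s<j in q , p) }
  ; irrefl = λ { refl (s , before , at , after) → at refl }
  }

-- The letter 1.

𝟏 : ∀ {n} → .{{_ : NonZero n}} → Fin n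
𝟏 {suc n} = zero

E₁ : ∀ {n k} → Word n k → Pred (Word n (suc (suc k))) 0ℓ
E₁ v w = ∃[ α ] w ≡ v ∷ʳ α ∷ʳ α

E₂ : ∀ {n m} → Word n (suc m) → Pred (Word n (suc (suc (suc m)))) 0ℓ
E₂ v w = ∃[ α ] ∃[ β ] α ≢ last v × β ≢ last v × w ≡ init v ∷ʳ α ∷ʳ β ∷ʳ last v

-- For a word v of length m + 1, an element ℓ of Fin m stands for a pair of
-- consecutive positions: v_ℓ is lookup v (inject₁ ℓ) and v_{ℓ+1} is
-- lookup v (suc ℓ).

ChangesAt : ∀ {n m} → Word n (suc m) → Pred (Fin m) 0ℓ
ChangesAt v ℓ = lookup v (inject₁ ℓ) ≢ lookup v (suc ℓ)

LastChange : ∀ {n m} → Word n (suc m) → Pred (Fin m) 0ℓ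
LastChange v ℓ = ℓ ∈ ChangesAt v × (∀ j → j ∈ ChangesAt v → j ≤ ℓ)

-- v₁ ⋯ v_{ℓ-1} v_{ℓ+1} v_ℓ ⋯ v_ℓ, of the same length as v.  In E₃ that length
-- is t - 2, so v_ℓ is repeated t - ℓ - 2 times.

swapAt : ∀ {n m} → Word n (suc m) → Fin m → Word n (suc m)
swapAt {m = suc m} (x ∷ y ∷ v) zero    = y ∷ replicate (suc m) x
swapAt             (x ∷ v)     (suc ℓ) = x ∷ swapAt v ℓ

-- A constant word has no LastChange, so E₃ of it is empty.

E₃ : ∀ {n m} → Word n (suc m) → Pred (Word n (suc (suc (suc m)))) 0ℓ
E₃ v w = ∃[ ℓ ] ℓ ∈ LastChange v ×
  (let vₗ = lookup v (inject₁ ℓ) in ∃[ α ] α ≢ vₗ × w ≡ swapAt v ℓ ∷ʳ α ∷ʳ vₗ)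

-- The part of D n t, for t = m + 3, that comes from the word 1^{t-2}; the
-- first argument is the parity of t.

FromOnes : ∀ {n m} → .{{_ : NonZero n}} → Parity → Pred (Word n (suc (suc (suc m)))) 0ℓ
FromOnes {m = m} 1ℙ   = E₁ (replicate (suc m) 𝟏) ∪ E₂ (replicate (suc m) 𝟏)
FromOnes {m = m} 0ℙ w = ∃[ α ] w ≡ replicate (suc m) 𝟏 ∷ʳ α ∷ʳ 𝟏

-- Only t ≥ 1 is meaningful; the value at t = 0 is a dummy and is not used by
-- the recursion.

D : ∀ n → .{{_ : NonZero n}} → ∀ t → Pred (Word n t) 0ℓ
D n 0                         = ∅
D n 1                         = ｛ 𝟏 ∷ [] ｝
D n 2                       w = ∃[ α ] w ≡ α ∷ 𝟏 ∷ []
D n t@(suc (suc (suc m)))   w =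
    w ∈ FromOnes (parity t)
  ⊎ (∃[ v ] v ∈ D n (suc m) ∖ ｛ replicate (suc m) 𝟏 ｝ × w ∈ E₁ v ∪ E₂ v ∪ E₃ v)

{-# OPTIONS --safe #-}
-- Let x be a word of length t - 2 and b, d two more letters; by induction x
-- lies in D n (t - 2) or has a neighbour v there.  In the first case E₁ x
-- dominates x b d.  In the second case, whether the edge x v stays inside a
-- clique (E₂) or not (E₃), there is a letter p such that all x α p with α ≢ p
-- are in D n t, and x p p is adjacent to some v q q in E₁ v.  These words
-- dominate every x b d.  For even t the word 1^{t-2} provides neither E₁ nor
-- E₂, but 1^{t-2} b 1 dominates 1^{t-2} b d, and the neighbours 1^{t-3} a of
-- 1^{t-2} are also adjacent to 1^{t-4} a 1, a nonconstant word of D n (t - 2).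
module Submission where

open import Defs
open import Data.Nat.Base using (ℕ; zero; suc; NonZero; _≥_; z≤n; s≤s; s<s; parity; ≢-nonZero⁻¹)
open import Data.Fin.Base using (Fin; zero; suc; inject₁)
open import Data.Fin.Properties using (_≟_)
open import Data.Parity.Base using (0ℙ; 1ℙ)
open import Data.Product.Base using (∃-syntax; _×_; _,_)
open import Data.Sum.Base using (_⊎_; inj₁; inj₂; map₂)
open import Data.Vec.Base using (Vec; []; _∷_; _∷ʳ_; lookup; replicate; initLast)
open import Data.Vec.Properties
  using (≡-dec; lookup-replicate; init-∷ʳ; last-∷ʳ; ∷ʳ-injectiveˡ; ∷ʳ-injectiveʳ)
open import Level using (0ℓ)
open import Relation.Binary.PropositionalEquality
  using (_≡_; _≢_; refl; sym; trans; cong; cong₂; subst; subst₂)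
open import Relation.Nullary using (yes; no; contradiction)
open import Relation.Unary using (Pred; _∈_; _∉_; _⊆_)

private variable
  n m k : ℕ

replicate-∷ʳ : ∀ {A : Set} k (x : A) → replicate k x ∷ʳ x ≡ replicate (suc k) x
replicate-∷ʳ zero    x = refl
replicate-∷ʳ (suc k) x = cong (x ∷_) (replicate-∷ʳ k x)

infix 4 _~_

-- Adjacency as an inductive relation: `swap` has the position s of `SierpińskiAdj` at the head and
-- each `_∷_` moves it one place right, so edges allow recursion on the common prefix.
data _~_ {n} : Word n m → Word n m → Set where
  swap : ∀ {a b} → a ≢ b → a ∷ replicate m b ~ b ∷ replicate m a
  _∷_  : ∀ x {u v : Word n m} → u ~ v → x ∷ u ~ x ∷ v

~⇒Adj : {u v : Word n m} → u ~ v → SierpińskiAdj n m u v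
~⇒Adj (swap a≢b) = zero , (λ _ ()) , a≢b , λ where
  (suc j) _ → lookup-replicate j _ , lookup-replicate j _
~⇒Adj (x ∷ e) with ~⇒Adj e
... | s , before , at , after = suc s
  , (λ { zero _ → refl ; (suc j) (s<s j<s) → before j j<s })
  , at
  , (λ { (suc j) (s<s s<j) → after j s<j })

module _ {a b : Fin n} (a≢b : a ≢ b) where

  last-~ : (xs : Word n k) → xs ∷ʳ a ~ xs ∷ʳ b
  last-~ []       = swap a≢b
  last-~ (x ∷ xs) = x ∷ last-~ xs

  last₂-~ : (xs : Word n k) → xs ∷ʳ a ∷ʳ b ~ xs ∷ʳ b ∷ʳ a
  last₂-~ []       = swap a≢b
  last₂-~ (x ∷ xs) = x ∷ last₂-~ xs

  last₃-~ : (xs : Word n k) → xs ∷ʳ a ∷ʳ b ∷ʳ b ~ xs ∷ʳ b ∷ʳ a ∷ʳ a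
  last₃-~ []       = swap a≢b
  last₃-~ (x ∷ xs) = x ∷ last₃-~ xs

  swap-∷ʳ² : ∀ k → a ∷ (replicate k b ∷ʳ b ∷ʳ b) ~ b ∷ (replicate k a ∷ʳ a ∷ʳ a)
  swap-∷ʳ² k = subst₂ (λ u v → a ∷ u ~ b ∷ v) (sym (eq b)) (sym (eq a)) (swap a≢b)
    where
    eq : ∀ x → replicate k x ∷ʳ x ∷ʳ x ≡ replicate (suc (suc k)) x
    eq x = trans (cong (_∷ʳ x) (replicate-∷ʳ k x)) (replicate-∷ʳ (suc k) x)

replicate-unchanging : ∀ (x : Fin n) (j : Fin m) →
  lookup (replicate (suc m) x) (inject₁ j) ≡ lookup (replicate (suc m) x) (suc j)
replicate-unchanging x j =
  trans (lookup-replicate (inject₁ j) x) (sym (lookup-replicate (suc j) x))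

LastChange-swap : ∀ {a b : Fin n} → b ≢ a → LastChange (b ∷ a ∷ replicate k a) zero
LastChange-swap b≢a = b≢a , λ where
  zero    _       → z≤n
  (suc j) changes → contradiction (replicate-unchanging _ j) changes

LastChange-∷ : ∀ x {v : Word n (suc m)} {ℓ} → LastChange v ℓ → LastChange (x ∷ v) (suc ℓ)
LastChange-∷ x (changes , greatest) = changes , λ where
  zero    _        → z≤n
  (suc j) changes′ → s≤s (greatest j changes′)

-- Inner edges are those inside one of the n-cliques; an outer edge at v swaps
-- the letters at the last change of v.

data Edge {n} : Word n (suc m) → Word n (suc m) → Set where
  inner : ∀ (xs : Word n m) {a c} → a ≢ c → Edge (xs ∷ʳ a) (xs ∷ʳ c)
  outer : ∀ {v : Word n (suc m)} {ℓ} → LastChange v ℓ → ∀ q →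
          (let p = lookup v (inject₁ ℓ)) →
          swapAt v ℓ ∷ʳ p ∷ʳ p ~ v ∷ʳ q ∷ʳ q →
          Edge (swapAt v ℓ) v

edge : {u v : Word n (suc m)} → u ~ v → Edge u v
edge {m = zero}  (swap a≢b) = inner [] a≢b
edge {m = suc m} (swap {a = a} {b} a≢b) =
  -- The second word is b a ⋯ a, so p = b and q = a, and the appended letters only lengthen the
  -- constant tails.
  outer (LastChange-swap λ b≡a → a≢b (sym b≡a)) a (swap-∷ʳ² a≢b (suc m))
edge {m = suc m} (x ∷ e) with edge e
... | inner xs a≢c    = inner (x ∷ xs) a≢c
... | outer {v = _ ∷ _} last q e′ = outer (LastChange-∷ x last) q (x ∷ e′)

Dominated : Pred (Word n m) 0ℓ → Pred (Word n m) 0ℓ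
Dominated P w = w ∈ P ⊎ (∃[ u ] u ∈ P × w ~ u)

module _ {P : Pred (Word n (suc (suc k))) 0ℓ} where

  dominated-by-clique : ∀ (xs : Word n (suc k)) {a b} → xs ∷ʳ b ∈ P → xs ∷ʳ a ∈ Dominated P
  dominated-by-clique xs {a} {b} xsb∈P with a ≟ b
  ... | yes refl = inj₁ xsb∈P
  ... | no  a≢b  = inj₂ (xs ∷ʳ b , xsb∈P , last-~ a≢b xs)

  dominated-by-E₁ : ∀ (v : Word n k) {b d} → E₁ v ⊆ P → v ∷ʳ b ∷ʳ d ∈ Dominated P
  dominated-by-E₁ v {b} E₁⊆P = dominated-by-clique (v ∷ʳ b) (E₁⊆P (b , refl))

  -- For b ≢ p, the word x b p is in the clique of x b d. For d ≢ p, x p d is adjacent to x d p.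
  -- Only x p p is left, and `z` takes care of it.
  dominated-by-column : ∀ (x : Word n k) p {z} →
    (∀ α → α ≢ p → x ∷ʳ α ∷ʳ p ∈ P) → z ∈ P → x ∷ʳ p ∷ʳ p ~ z →
    ∀ b d → x ∷ʳ b ∷ʳ d ∈ Dominated P
  dominated-by-column x p column z∈P e b d with b ≟ p | d ≟ p
  ... | no b≢p   | _        = dominated-by-clique (x ∷ʳ b) (column b b≢p)
  ... | yes refl | yes refl = inj₂ (_ , z∈P , e)
  ... | yes refl | no d≢p   =
    inj₂ (_ , column d d≢p , last₂-~ (λ p≡d → d≢p (sym p≡d)) x)

dominated-by-edge : {P : Pred (Word n (suc (suc (suc m)))) 0ℓ} {x v : Word n (suc m)} →
  E₁ v ⊆ P → E₂ v ⊆ P → E₃ v ⊆ P → Edge x v →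
  ∀ b d → x ∷ʳ b ∷ʳ d ∈ Dominated P
dominated-by-edge {P = P} E₁⊆P E₂⊆P E₃⊆P (inner xs {a} {c} a≢c) =
  dominated-by-column (xs ∷ʳ a) c column (E₁⊆P (a , refl)) (last₃-~ a≢c xs)
  where
  column : ∀ β → β ≢ c → xs ∷ʳ a ∷ʳ β ∷ʳ c ∈ P
  -- The first free letter of `E₂` is fixed as a, which is allowed because a differs from the last
  -- letter c.
  column β β≢c = E₂⊆P
    ( a , β
    , (λ eq → a≢c (trans eq (last-∷ʳ c xs)))
    , (λ eq → β≢c (trans eq (last-∷ʳ c xs)))
    , sym (cong₂ (λ ys y → ys ∷ʳ a ∷ʳ β ∷ʳ y) (init-∷ʳ c xs) (last-∷ʳ c xs)) )
dominated-by-edge E₁⊆P E₂⊆P E₃⊆P (outer last q e) =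
  -- `E₃` is precisely the column over `swapAt v ℓ` with p = v_ℓ.
  dominated-by-column _ _ (λ α α≢p → E₃⊆P (_ , last , α , α≢p , refl)) (E₁⊆P (q , refl)) e

module _ .{{_ : NonZero n}} where

  ones : ∀ k → Word n k
  ones k = replicate k 𝟏

  ones-not-∷ʳ² : ∀ (xs : Word n k) {a b} → a ≢ 𝟏 → ones (suc (suc k)) ≢ xs ∷ʳ a ∷ʳ b
  ones-not-∷ʳ² {k} xs a≢1 eq = a≢1 (sym (∷ʳ-injectiveʳ (ones k) xs
    (∷ʳ-injectiveˡ _ _ (trans (cong (_∷ʳ 𝟏) (replicate-∷ʳ k 𝟏))
                              (trans (replicate-∷ʳ (suc k) 𝟏) eq)))))

  ∉E₃-ones : ∀ {w : Word n (suc (suc (suc m)))} → w ∉ E₃ (ones (suc m))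
  ∉E₃-ones (ℓ , (changes , _) , _) = contradiction (replicate-unchanging 𝟏 ℓ) changes

  -- `parity` recurses in steps of two, so t and t - 2 have the same parity by computation.
  fromOnes : ∀ {q w} → parity (suc m) ≡ q → w ∈ FromOnes q → w ∈ D n (suc (suc (suc m)))
  fromOnes refl = inj₁

  ∷ʳ-𝟏∈D : ∀ k (a : Fin n) → parity k ≡ 0ℙ → ones k ∷ʳ a ∷ʳ 𝟏 ∈ D n (suc (suc k))
  ∷ʳ-𝟏∈D zero    a even = a , refl
  ∷ʳ-𝟏∈D (suc k) a even = fromOnes even (a , refl)

  dominated-by-nonconstant : ∀ {x v : Word n (suc m)} → v ∈ D n (suc m) → ones (suc m) ≢ v →
    x ~ v → ∀ b d → x ∷ʳ b ∷ʳ d ∈ Dominated (D n (suc (suc (suc m))))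
  dominated-by-nonconstant v∈D ≢v e = dominated-by-edge
    (λ w∈ → inj₂ (_ , (v∈D , ≢v) , inj₁ w∈))
    (λ w∈ → inj₂ (_ , (v∈D , ≢v) , inj₂ (inj₁ w∈)))
    (λ w∈ → inj₂ (_ , (v∈D , ≢v) , inj₂ (inj₂ w∈)))
    (edge e)

  dominated-ones : ∀ q → parity (suc m) ≡ q →
    ∀ b d → ones (suc m) ∷ʳ b ∷ʳ d ∈ Dominated (D n (suc (suc (suc m))))
  dominated-ones 1ℙ odd  b d = dominated-by-E₁ (ones _) (λ w∈ → fromOnes odd (inj₁ w∈))
  dominated-ones 0ℙ even b d = dominated-by-clique (ones _ ∷ʳ b) (fromOnes even (b , refl))

  -- A constant word has no last change, so no outer edge ends there.
  Edge-ones : ∀ {x v : Word n (suc m)} → ones (suc m) ≡ v → Edge x v →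
    ∃[ a ] a ≢ 𝟏 × x ≡ ones m ∷ʳ a
  Edge-ones {m} eq (inner xs {a} {c} a≢c)
    with trans (replicate-∷ʳ m 𝟏) eq
  ... | eq′ with ∷ʳ-injectiveˡ (ones m) xs eq′ | ∷ʳ-injectiveʳ (ones m) xs eq′
  ... | refl | refl = a , a≢c , refl
  Edge-ones refl (outer {ℓ = ℓ} (changes , _) _ _) =
    contradiction (replicate-unchanging 𝟏 ℓ) changes

  dominated-by-ones : ∀ {x : Word n (suc m)} q → parity (suc m) ≡ q → x ~ ones (suc m) →
    ∀ b d → x ∷ʳ b ∷ʳ d ∈ Dominated (D n (suc (suc (suc m))))
  dominated-by-ones 1ℙ odd e = dominated-by-edge
    (λ w∈ → fromOnes odd (inj₁ w∈)) (λ w∈ → fromOnes odd (inj₂ w∈))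
    (λ w∈ → contradiction w∈ ∉E₃-ones) (edge e)
  -- Even length forces `m` to be a successor, which leaves room for the nonconstant neighbour 1^k a
  -- 1 of x = 1^k 1 a.
  dominated-by-ones {m = suc k} 0ℙ even e with Edge-ones refl (edge e)
  ... | a , a≢1 , refl = dominated-by-nonconstant
    (∷ʳ-𝟏∈D k a even) (ones-not-∷ʳ² (ones k) a≢1)
    (subst (λ u → u ∷ʳ a ~ ones k ∷ʳ a ∷ʳ 𝟏) (replicate-∷ʳ k 𝟏)
           (last₂-~ (λ 1≡a → a≢1 (sym 1≡a)) (ones k)))

  dominated-∷ʳ² : ∀ {x : Word n (suc m)} → x ∈ Dominated (D n (suc m)) →
    ∀ b d → x ∷ʳ b ∷ʳ d ∈ Dominated (D n (suc (suc (suc m))))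
  dominated-∷ʳ² {m} {x} (inj₁ x∈D) b d with ≡-dec _≟_ (ones (suc m)) x
  ... | yes refl = dominated-ones _ refl b d
  ... | no  ≢x   = dominated-by-E₁ x (λ w∈ → inj₂ (x , (x∈D , ≢x) , inj₁ w∈))
  dominated-∷ʳ² {m} (inj₂ (v , v∈D , e)) with ≡-dec _≟_ (ones (suc m)) v
  ... | yes refl = dominated-by-ones _ refl e
  ... | no  ≢v   = dominated-by-nonconstant v∈D ≢v e

  dominated : ∀ m (w : Word n (suc m)) → w ∈ Dominated (D n (suc m))
  dominated zero (a ∷ []) with a ≟ 𝟏
  ... | yes refl = inj₁ refl
  ... | no  a≢1  = inj₂ (𝟏 ∷ [] , refl , swap a≢1)
  dominated (suc zero) (a ∷ b ∷ []) = dominated-by-clique (a ∷ []) (a , refl)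
  dominated (suc (suc m)) w with initLast w
  ... | w′ , d , refl with initLast w′
  ... | x , b , refl = dominated-∷ʳ² (dominated m x) b d

theorem2p6 : ∀ (n t : ℕ) → .{{_ : NonZero n}} → .{{_ : NonZero t}} → n ≥ 2 → Dominating (S n t) (D n t)
theorem2p6 n zero    _ _ = contradiction refl (≢-nonZero⁻¹ 0)
theorem2p6 n (suc m) _ w = map₂ (λ (u , u∈D , e) → u , u∈D , ~⇒Adj e) (dominated m w)
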